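{- Let $\alpha_i\ge 0$, $\beta_i>0$ ($1\le i\le 5$) and $Q>0$ be real numbers. In the network $N^+$ with these parameters and total flow $Q$, the travel time at equilibrium is as follows: (a) $T^+_{Eq}=\alpha_{135}+Q\beta_{135}$ if $0<Q\le\min\{\hat\alpha/\beta_{35},\,\bar\alpha/\beta_{13}\}$; (b) $T^+_{Eq}=\alpha_{45}+Q\beta_{45}$ if $0<Q\le\min\{ -\alpha/\beta_{45},\,-\bar\alpha/\beta_4\}$; (c) $T^+_{Eq}=\alpha_{12}+Q\beta_{12}$ if $0<Q\le\min\{\alpha/\beta_{12},\,-\hat\alpha/\beta_2\}$; (d) $T^+_{Eq}=\alpha_{45}+Q\beta_{45}-(\bar\alpha+Q\beta_4)\beta_4/\beta_{134}$ if $\max\{\bar\alpha/\beta_{13},\,-\bar\alpha/\beta_4\}<Q\le\mu_1$; (e) $T^+_{Eq}=\alpha_{12}+Q\beta_{12}-(\hat\alpha+Q\beta_2)\beta_2/\beta_{235}$ if $\max\{\hat\alpha/\beta_{35},\,-\hat\alpha/\beta_2\}<Q\le\mu_2$; (f) $T^+_{Eq}=\alpha_{12}+(\alpha+Q\beta_{45})\beta_{12}/\beta$ if $Q>\max\{\alpha/\beta_{12},\,-\alpha/\beta_{45}\}$ and $\mathcal B_1\ge\dfrac{\hat\alpha\beta_{14}+\bar\alpha\beta_{25}}{Q}$; (g) $T^+_{Eq}=\alpha_{12}+(\alpha+Q\beta_{45})\beta_{12}/\beta+g\mathcal B_1/\beta$, where $$g=\frac{\bar\alpha\beta-\alpha\beta_{14}-Q\mathcal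 B_1}{\beta_3\beta+\beta_{14}\beta_{25}},$$ if $Q>\max\{\mu_1,\mu_2\}$ and $\mathcal B_1<\dfrac{\hat\alpha\beta_{14}+\bar\alpha\beta_{25}}{Q}$.
   Context: The network $N^+$ has nodes $a,b,c,d$ and directed links $(a,b),(b,d),(b,c),(a,c),(c,d)$ with travel times $\alpha_1+\beta_1f_{ab}$, $\alpha_2+\beta_2f_{bd}$, $\alpha_3+\beta_3f_{bc}$, $\alpha_4+\beta_4f_{ac}$, $\alpha_5+\beta_5f_{cd}$ respectively, where $f_{ij}\ge 0$ is the (real) flow on link $(i,j)$ and $\alpha_i\ge 0$, $\beta_i>0$. All traffic, of total amount $Q>0$ (real), goes from $a$ to $d$ along the paths $P_1=a-b-d$, $P_2=a-c-d$, $P_3=a-b-c-d$. A flow assigns a non-negative real amount to each path, with total $Q$; the flow on a link is the sum of the flows of the paths containing it; the travel time on a path is the sum of the travel times of its links. A path has vanishing flow if its path flow is $0$. The network is at equilibrium if all paths with non-vanishing flow have the same travel time, and every path with vanishing flow has travel time at least this common value. The equilibrium exists and is unique; its common travel time is denoted $T^+_{Eq}$. Notation: multiple indices denote sums, e.g. $\alpha_{ij}=\alpha_i+\alpha_j$, $\beta_{134}=\beta_1+\beta_3+\beta_4$. Further, $\alpha=\alpha_{45}-\alpha_{12}$, $\bar\alpha=\alpha_4-\alpha_{13}$, $\hat\alpha=\alpha_2-\alpha_{35}$, $\beta=\beta_1+\beta_2+\beta_4+\beta_5$, $\mathcal B_1=\beta_1\beta_5-\beta_2\beta_4$, and $$\mu_1=\frac{\hat\alpha\beta_{14}-\alpha\beta_3}{\beta_3\beta_{45}+\beta_5\beta_{14}},\qquad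 \mu_2=\frac{\bar\alpha\beta_{25}+\alpha\beta_3}{\beta_1\beta_{25}+\beta_3\beta_{12}}.$$ -}

module Defs where

open import Level using (Level; suc) renaming (_⊔_ to _⊔ˡ_)
open import Algebra.Apartness.Bundles using (HeytingField; HeytingCommutativeRing)
open import Algebra.Apartness.Structures using (IsHeytingField)
open import Algebra.Bundles using (CommutativeRing)
open import Data.List.Base using (List; []; _∷_; map; foldr; filter)
import Data.List.Membership.DecPropositional as DecMembership
open import Data.Nat.Base as ℕ using (ℕ)
import Data.Nat.Properties as ℕ
open import Data.Product.Base using (∃-syntax; _×_; _,_; proj₁; proj₂)
open import Data.Sum.Base using (_⊎_; inj₁; inj₂)
open import Relation.Binary.Core using (Rel)
open import Relation.Binary.Definitions using (DecidableEquality)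
open import Relation.Binary.Lattice.Definitions using (Supremum; Infimum)
open import Relation.Binary.PropositionalEquality using (_≡_; refl; cong)
open import Relation.Binary.Structures using (IsStrictPartialOrder)
open import Relation.Nullary using (¬_)
open import Relation.Nullary.Decidable using (map′)

private
  variable
    c ℓ₁ ℓ₂ : Level

-- The axioms do not presuppose a decidable order, so that constructive reals
-- qualify as well as classical ones.  For a total order, `x ≤ y` below is
-- equivalent to `x < y ⊎ x ≈ y`, and `_⊓_`, `_⊔_` are the minimum and maximum.

record OrderedField c ℓ₁ ℓ₂ : Set (suc (c ⊔ˡ ℓ₁ ⊔ˡ ℓ₂)) where
  infix  8 -_
  infixl 7 _*_
  infixr 7 _⊓_
  infixl 6 _+_
  infixr 6 _⊔_
  infix  4 _≈_ _<_ _≤_ _#_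
  field
    Carrier : Set c
    _≈_     : Rel Carrier ℓ₁
    _<_     : Rel Carrier ℓ₂
    _+_     : Carrier → Carrier → Carrier
    _*_     : Carrier → Carrier → Carrier
    -_      : Carrier → Carrier
    0#      : Carrier
    1#      : Carrier
    _⊓_     : Carrier → Carrier → Carrier
    _⊔_     : Carrier → Carrier → Carrier

  _#_ : Rel Carrier ℓ₂
  x # y = x < y ⊎ y < x

  _≤_ : Rel Carrier ℓ₂
  x ≤ y = ¬ (y < x)

  field
    isHeytingField         : IsHeytingField _≈_ _#_ _+_ _*_ -_ 0# 1#
    <-isStrictPartialOrder : IsStrictPartialOrder _≈_ _<_
    +-monoʳ-<              : ∀ x {y z} → y < z → x + y < x + z
    *-pos                  : ∀ {x y} → 0# < x → 0# < y → 0# < x * y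
    ⊓-infimum              : Infimum _≤_ _⊓_
    ⊔-supremum             : Supremum _≤_ _⊔_

  heytingField : HeytingField c ℓ₁ ℓ₂
  heytingField = record { isHeytingField = isHeytingField }

  open HeytingField heytingField public
    using (_-_; #⇒invertible; heytingCommutativeRing)
  open HeytingCommutativeRing heytingCommutativeRing public
    using (commutativeRing)

  open import Algebra.Definitions.RawMonoid
    (CommutativeRing.+-rawMonoid commutativeRing)
    public using () renaming (_×_ to _·_)

  ∣_∣ : Carrier → Carrier
  ∣ x ∣ = x ⊔ (- x)

  private
    module F = HeytingField heytingField
    module < = IsStrictPartialOrder <-isStrictPartialOrder

  -- Used as an instance argument, so that denominators built from positive
  -- parameters by sums and products need no explicit proof.
  record Positive (x : Carrier) : Set ℓ₂ where
    eta-equality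
    constructor positive
    field 0<x : 0# < x

  instance
    +-positive : ∀ {x y} ⦃ _ : Positive x ⦄ ⦃ _ : Positive y ⦄ → Positive (x + y)
    +-positive {x} ⦃ positive 0<x ⦄ ⦃ positive 0<y ⦄ = positive
      (<.trans 0<x (<.<-respˡ-≈ (F.+-identityʳ x) (+-monoʳ-< x 0<y)))

    *-positive : ∀ {x y} ⦃ _ : Positive x ⦄ ⦃ _ : Positive y ⦄ → Positive (x * y)
    *-positive ⦃ positive 0<x ⦄ ⦃ positive 0<y ⦄ = positive (*-pos 0<x 0<y)

  -- `#⇒invertible` inverts `x - 0#`, which equals `x`; see `⁻¹-inverseʳ`.
  infix 8 _⁻¹
  _⁻¹ : ∀ x → ⦃ Positive x ⦄ → Carrier
  (x ⁻¹) ⦃ positive 0<x ⦄ = proj₁ (#⇒invertible {x} {0#} (inj₂ 0<x))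

  infixl 7 _/_
  _/_ : ∀ x y → ⦃ Positive y ⦄ → Carrier
  x / y = x * y ⁻¹

  ⁻¹-inverseʳ : ∀ x ⦃ _ : Positive x ⦄ → x * x ⁻¹ ≈ 1#
  ⁻¹-inverseʳ x ⦃ positive 0<x ⦄ =
    F.trans (F.*-congʳ (F.sym (x-0≈x x)))
            (proj₂ (proj₂ (#⇒invertible {x} {0#} (inj₂ 0<x))))
    where
    open import Algebra.Apartness.Properties.HeytingCommutativeRing
      heytingCommutativeRing using (x-0≈x)

-- The real numbers, axiomatised as an Archimedean, Cauchy-complete ordered
-- field.  Classically these axioms determine ℝ up to isomorphism.

record Reals c ℓ₁ ℓ₂ : Set (suc (c ⊔ˡ ℓ₁ ⊔ˡ ℓ₂)) where
  field
    orderedField : OrderedField c ℓ₁ ℓ₂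

  open OrderedField orderedField public

  field
    archimedean : ∀ x → ∃[ n ] x < n · 1#
    complete    : (s : ℕ → Carrier) →
                  (∀ ε → 0# < ε →
                     ∃[ N ] ∀ m n → N ℕ.≤ m → N ℕ.≤ n → ∣ s m - s n ∣ < ε) →
                  ∃[ x ] ∀ ε → 0# < ε →
                     ∃[ N ] ∀ n → N ℕ.≤ n → ∣ s n - x ∣ < ε

data Link : Set where
  ab bd bc ac cd : Link

data Path : Set where
  P₁ P₂ P₃ : Path

links : Path → List Link
links P₁ = ab ∷ bd ∷ []
links P₂ = ac ∷ cd ∷ []
links P₃ = ab ∷ bc ∷ cd ∷ []

paths : List Path
paths = P₁ ∷ P₂ ∷ P₃ ∷ []

_≟_ : DecidableEquality Link
x ≟ y = map′ (index-injective x y) (cong index) (index x ℕ.≟ index y)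
  where
  index : Link → ℕ
  index ab = 1
  index bd = 2
  index bc = 3
  index ac = 4
  index cd = 5

  index-injective : ∀ x y → index x ≡ index y → x ≡ y
  index-injective ab ab _ = refl
  index-injective bd bd _ = refl
  index-injective bc bc _ = refl
  index-injective ac ac _ = refl
  index-injective cd cd _ = refl

open DecMembership _≟_ using (_∈?_)

-- The network with link travel times `αₗ l + βₗ l * (flow on l)`.

record Network (ℝ : Reals c ℓ₁ ℓ₂) : Set (c ⊔ˡ ℓ₂) where
  open Reals ℝ
  field
    αₗ βₗ      : Link → Carrier
    αₗ-nonneg  : ∀ l → 0# ≤ αₗ l
    βₗ-pos     : ∀ l → Positive (βₗ l)

  instance
    βₗ-positive : ∀ {l} → Positive (βₗ l)
    βₗ-positive {l} = βₗ-pos l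

  sum : List Carrier → Carrier
  sum = foldr _+_ 0#

  linkFlow : (Path → Carrier) → Link → Carrier
  linkFlow f l = sum (map f (filter (λ p → l ∈? links p) paths))

  linkTime : (Path → Carrier) → Link → Carrier
  linkTime f l = αₗ l + βₗ l * linkFlow f l

  pathTime : (Path → Carrier) → Path → Carrier
  pathTime f p = sum (map (linkTime f) (links p))

  record IsFlow (Q : Carrier) (f : Path → Carrier) : Set (c ⊔ˡ ℓ₁ ⊔ˡ ℓ₂) where
    field
      nonneg : ∀ p → 0# ≤ f p
      total  : sum (map f paths) ≈ Q

  -- `f` is an equilibrium flow of total amount `Q` whose common travel time
  -- is `T`.
  record IsEquilibrium (Q : Carrier) (f : Path → Carrier) (T : Carrier)
         : Set (c ⊔ˡ ℓ₁ ⊔ˡ ℓ₂) where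
    field
      isFlow       : IsFlow Q f
      nonVanishing : ∀ p → ¬ (f p ≈ 0#) → pathTime f p ≈ T
      vanishing    : ∀ p → f p ≈ 0# → T ≤ pathTime f p

  -- `T⁺Eq[ Q ]≈ T`: the travel time at equilibrium is `T`, i.e. an equilibrium
  -- with common travel time `T` exists, and `T` is the common travel time of
  -- every equilibrium.
  T⁺Eq[_]≈_ : Carrier → Carrier → Set (c ⊔ˡ ℓ₁ ⊔ˡ ℓ₂)
  T⁺Eq[ Q ]≈ T = (∃[ f ] IsEquilibrium Q f T)
               × (∀ f T′ → IsEquilibrium Q f T′ → T′ ≈ T)

  infix 4 T⁺Eq[_]≈_

  α₁ α₂ α₃ α₄ α₅ α₁₂ α₁₃ α₃₅ α₄₅ α₁₃₅ : Carrier
  α₁ = αₗ ab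
  α₂ = αₗ bd
  α₃ = αₗ bc
  α₄ = αₗ ac
  α₅ = αₗ cd
  α₁₂ = α₁ + α₂
  α₁₃ = α₁ + α₃
  α₃₅ = α₃ + α₅
  α₄₅ = α₄ + α₅
  α₁₃₅ = α₁ + α₃ + α₅

  β₁ β₂ β₃ β₄ β₅ β₁₂ β₁₃ β₁₄ β₂₅ β₃₅ β₄₅ β₁₃₄ β₁₃₅ β₂₃₅ : Carrier
  β₁ = βₗ ab
  β₂ = βₗ bd
  β₃ = βₗ bc
  β₄ = βₗ ac
  β₅ = βₗ cd
  β₁₂ = β₁ + β₂
  β₁₃ = β₁ + β₃
  β₁₄ = β₁ + β₄
  β₂₅ = β₂ + β₅
  β₃₅ = β₃ + β₅
  β₄₅ = β₄ + β₅
  β₁₃₄ = β₁ + β₃ + β₄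
  β₁₃₅ = β₁ + β₃ + β₅
  β₂₃₅ = β₂ + β₃ + β₅

  α ᾱ α̂ β 𝓑₁ μ₁ μ₂ : Carrier
  α  = α₄₅ - α₁₂
  ᾱ  = α₄ - α₁₃
  α̂  = α₂ - α₃₅
  β  = β₁ + β₂ + β₄ + β₅
  𝓑₁ = β₁ * β₅ - β₂ * β₄
  μ₁ = (α̂ * β₁₄ - α * β₃) / (β₃ * β₄₅ + β₅ * β₁₄)
  μ₂ = (ᾱ * β₂₅ + α * β₃) / (β₁ * β₂₅ + β₃ * β₁₂)

{-# OPTIONS --safe #-}
module Submission where

-- Existence: the equilibrium flow is exhibited in each case by equalising the
-- travel times of the paths in use; the hypotheses on Q say that its path flows
-- are non-negative and that the unused paths are not faster.
--
-- Uniqueness: by complementarity, two equilibria f, f′ satisfy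
-- Σₚ (fₚ - f′ₚ) (tₚ - t′ₚ) ≤ 0, while the left-hand side equals Σₗ βₗ dₗ² for the
-- differences dₗ of the link flows.  Hence these vanish, and already the links bd,
-- ac, bc, each on a single path, give f = f′.  Some path carries flow because
-- Q > 0, and it has the common travel time of both equilibria.

open import Defs
open import Level as Level using (Level)
open import Algebra.Apartness.Bundles using (HeytingField)
open import Algebra.Bundles using (CommutativeRing)
open import Algebra.Solver.Ring.AlmostCommutativeRing using (fromCommutativeRing; _-Raw-AlmostCommutative⟶_)
open import Data.Empty using (⊥-elim)
open import Data.Integer.Base as ℤ using (ℤ; +_; -[1+_]; _⊖_)
import Data.Integer.Properties as ℤ
open import Data.List.Base using ([]; _∷_; map)
open import Data.Maybe.Base as Maybe using ()
open import Data.Nat.Base as ℕ using (ℕ; zero; suc)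
open import Data.Product.Base using (_×_; _,_; proj₁; proj₂)
open import Data.Sum.Base using (_⊎_; inj₁; inj₂; [_,_])
open import Relation.Binary.PropositionalEquality.Core as ≡ using ()
open import Relation.Binary.Structures using (IsStrictPartialOrder)
open import Relation.Nullary using (¬_)
open import Relation.Nullary.Decidable using (dec⇒maybe)
import Relation.Binary.Reasoning.Setoid as SetoidReasoning

-- The canonical homomorphism from the integers to a commutative ring.

-- The ring solver with integer coefficients, so that it cancels `x - x`
-- although equality on the ring itself is undecidable.
module IntegerCoefficients {c ℓ} (R : CommutativeRing c ℓ) where
  open CommutativeRing R
  open import Algebra.Properties.Ring ring using (-0#≈0#; -‿distribˡ-*; -‿distribʳ-*; -‿involutive)
  open import Algebra.Properties.AbelianGroup +-abelianGroup using (⁻¹-∙-comm; //-rightDividesʳ)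
  open import Algebra.Properties.Semiring.Mult.TCOptimised semiring
    renaming (_×_ to _·_) using (×-homo-+; ×1-homo-*; 1+×)
  open SetoidReasoning setoid

  -- The optimised multiple reduces `1 · 1#` to `1#`, so `con (+ 1)` in a solver equation means `1#`
  -- definitionally.
  fromℤ : ℤ → Carrier
  fromℤ (+ n)      = n · 1#
  fromℤ (-[1+ n ]) = - (suc n · 1#)

  -- Written without subtraction, so that raising both arguments by one, which leaves `m ⊖ n`
  -- unchanged, just adds `1#` to both sides.
  fromℤ-⊖ : ∀ m n → fromℤ (m ⊖ n) + n · 1# ≈ m · 1#
  fromℤ-⊖ m       zero    = +-identityʳ (m · 1#)
  fromℤ-⊖ zero    (suc n) = -‿inverseˡ (suc n · 1#)
  fromℤ-⊖ (suc m) (suc n) = begin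
    fromℤ (suc m ⊖ suc n) + suc n · 1#
      ≈⟨ +-cong (reflexive (≡.cong fromℤ (ℤ.[1+m]⊖[1+n]≡m⊖n m n))) (1+× n 1#) ⟩
    fromℤ (m ⊖ n) + (1# + n · 1#)
      ≈⟨ +-congˡ (+-comm 1# (n · 1#)) ⟩
    fromℤ (m ⊖ n) + (n · 1# + 1#)
      ≈⟨ +-assoc _ _ _ ⟨
    fromℤ (m ⊖ n) + n · 1# + 1#
      ≈⟨ +-congʳ (fromℤ-⊖ m n) ⟩
    m · 1# + 1#
      ≈⟨ +-comm _ _ ⟩
    1# + m · 1#
      ≈⟨ 1+× m 1# ⟨
    suc m · 1# ∎

  fromℤ-⊖-suc : ∀ m n → fromℤ (m ⊖ suc n) ≈ m · 1# + fromℤ -[1+ n ]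
  fromℤ-⊖-suc m n = begin
    fromℤ (m ⊖ suc n)                              ≈⟨ //-rightDividesʳ (suc n · 1#) _ ⟨
    fromℤ (m ⊖ suc n) + suc n · 1# - suc n · 1#    ≈⟨ +-congʳ (fromℤ-⊖ m (suc n)) ⟩
    m · 1# - suc n · 1#                            ∎

  fromℤ-+ : ∀ i j → fromℤ (i ℤ.+ j) ≈ fromℤ i + fromℤ j
  fromℤ-+ (+ m)      (+ n)      = ×-homo-+ 1# m n
  fromℤ-+ (+ m)      (-[1+ n ]) = fromℤ-⊖-suc m n
  fromℤ-+ (-[1+ m ]) (+ n)      = trans (fromℤ-⊖-suc n m) (+-comm _ _)
  fromℤ-+ (-[1+ m ]) (-[1+ n ]) = begin
    - (suc (suc (m ℕ.+ n)) · 1#)      ≈⟨ -‿cong (1+× (suc (m ℕ.+ n)) 1#) ⟩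
    - (1# + suc (m ℕ.+ n) · 1#)       ≈⟨ -‿cong (+-congˡ (×-homo-+ 1# (suc m) n)) ⟩
    - (1# + (suc m · 1# + n · 1#))    ≈⟨ -‿cong (+-comm _ _) ⟩
    - (suc m · 1# + n · 1# + 1#)      ≈⟨ -‿cong (+-assoc _ _ _) ⟩
    - (suc m · 1# + (n · 1# + 1#))    ≈⟨ -‿cong (+-congˡ (+-comm _ _)) ⟩
    - (suc m · 1# + (1# + n · 1#))    ≈⟨ -‿cong (+-congˡ (1+× n 1#)) ⟨
    - (suc m · 1# + suc n · 1#)       ≈⟨ ⁻¹-∙-comm _ _ ⟨
    - (suc m · 1#) - suc n · 1#       ∎

  fromℤ-‿- : ∀ i → fromℤ (ℤ.- i) ≈ - fromℤ i
  fromℤ-‿- (+ zero)   = sym -0#≈0#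
  fromℤ-‿- (+ suc n)  = refl
  fromℤ-‿- (-[1+ n ]) = sym (-‿involutive _)

  fromℤ-+* : ∀ m j → fromℤ (+ m ℤ.* j) ≈ fromℤ (+ m) * fromℤ j
  fromℤ-+* m (+ n)      = trans (reflexive (≡.cong fromℤ (≡.sym (ℤ.pos-* m n)))) (×1-homo-* m n)
  fromℤ-+* m (-[1+ n ]) = begin
    fromℤ (+ m ℤ.* -[1+ n ])            ≡⟨ ≡.cong fromℤ (ℤ.neg-distribʳ-* (+ m) (+ suc n)) ⟨
    fromℤ (ℤ.- (+ m ℤ.* + suc n))       ≈⟨ fromℤ-‿- (+ m ℤ.* + suc n) ⟩
    - fromℤ (+ m ℤ.* + suc n)           ≈⟨ -‿cong (fromℤ-+* m (+ suc n)) ⟩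
    - (m · 1# * (suc n · 1#))           ≈⟨ -‿distribʳ-* _ _ ⟩
    m · 1# * - (suc n · 1#)             ∎

  fromℤ-* : ∀ i j → fromℤ (i ℤ.* j) ≈ fromℤ i * fromℤ j
  fromℤ-* (+ m)      j = fromℤ-+* m j
  fromℤ-* (-[1+ m ]) j = begin
    fromℤ (-[1+ m ] ℤ.* j)         ≡⟨ ≡.cong fromℤ (ℤ.neg-distribˡ-* (+ suc m) j) ⟨
    fromℤ (ℤ.- (+ suc m ℤ.* j))    ≈⟨ fromℤ-‿- (+ suc m ℤ.* j) ⟩
    - fromℤ (+ suc m ℤ.* j)        ≈⟨ -‿cong (fromℤ-+* (suc m) j) ⟩
    - (suc m · 1# * fromℤ j)       ≈⟨ -‿distribˡ-* _ _ ⟩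
    - (suc m · 1#) * fromℤ j       ∎

  homomorphism : ℤ.+-*-rawRing -Raw-AlmostCommutative⟶ fromCommutativeRing R
  homomorphism = record
    { ⟦_⟧    = fromℤ
    ; +-homo = fromℤ-+
    ; *-homo = fromℤ-*
    ; -‿homo = fromℤ-‿-
    ; 0-homo = refl
    ; 1-homo = refl
    }

  open import Algebra.Solver.Ring ℤ.+-*-rawRing (fromCommutativeRing R) homomorphism
    (λ i j → Maybe.map (λ eq → reflexive (≡.cong fromℤ eq)) (dec⇒maybe (i ℤ.≟ j))) public
    using (solve; _:=_; _:+_; _:*_; _:-_; :-_; con; Polynomial)

-- Inequalities and division when the order need not be decidable.

module OrderedFieldProperties {c ℓ₁ ℓ₂} (F : OrderedField c ℓ₁ ℓ₂) where
  open OrderedField F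
  open HeytingField heytingField using (tight; #-cotrans)
  open IsStrictPartialOrder <-isStrictPartialOrder public
    using () renaming (irrefl to <-irrefl; trans to <-trans; <-respˡ-≈ to <-respˡ; <-respʳ-≈ to <-respʳ)
  open CommutativeRing commutativeRing public
    using (refl; sym; trans; setoid; +-cong; +-congˡ; +-congʳ; +-identityˡ; +-identityʳ;
           *-cong; *-congˡ; *-congʳ; *-identityʳ; *-comm; zeroˡ; zeroʳ; -‿inverseʳ; -‿cong)
  open IntegerCoefficients commutativeRing public
    using (solve; _:=_; _:+_; _:*_; _:-_; :-_; con; Polynomial)
  open SetoidReasoning setoid

  private
    variable
      x y z : Carrier

  -- By tightness, equality is the negation of apartness, hence stable. This replaces case
  -- distinctions on equality with zero.
  ≈-stable : ¬ ¬ (x ≈ y) → x ≈ y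
  ≈-stable {x} {y} ¬¬x≈y = proj₁ (tight x y) (λ x#y → ¬¬x≈y (λ x≈y → proj₂ (tight x y) x≈y x#y))

  ≤-antisym : x ≤ y → y ≤ x → x ≈ y
  ≤-antisym {x} {y} x≤y y≤x = proj₁ (tight x y) [ y≤x , x≤y ]

  ≤-refl : x ≤ x
  ≤-refl = <-irrefl refl

  ≤-reflexive : x ≈ y → x ≤ y
  ≤-reflexive x≈y = <-irrefl (sym x≈y)

  <⇒≤ : x < y → x ≤ y
  <⇒≤ x<y y<x = <-irrefl refl (<-trans x<y y<x)

  positive⇒0≤ : ∀ x ⦃ _ : Positive x ⦄ → 0# ≤ x
  positive⇒0≤ x ⦃ positive 0<x ⦄ = <⇒≤ 0<x

  ≤-respʳ : y ≈ z → x ≤ y → x ≤ z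
  ≤-respʳ y≈z x≤y z<x = x≤y (<-respˡ (sym y≈z) z<x)

  -- The substitute for trichotomy: cotransitivity of apartness leaves four cases, and where `z`
  -- lies outside the interval, transitivity with `x < y` decides. Transitivity of the negatively
  -- defined `_≤_` rests on it.
  <-cotrans : x < y → ∀ z → x < z ⊎ z < y
  <-cotrans x<y z with #-cotrans (inj₁ x<y) z
  ... | inj₁ (inj₁ x<z) = inj₁ x<z
  ... | inj₁ (inj₂ z<x) = inj₂ (<-trans z<x x<y)
  ... | inj₂ (inj₁ z<y) = inj₂ z<y
  ... | inj₂ (inj₂ y<z) = inj₁ (<-trans x<y y<z)

  ≤-trans : x ≤ y → y ≤ z → x ≤ z
  ≤-trans x≤y y≤z z<x with <-cotrans z<x _
  ... | inj₁ z<y = y≤z z<y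
  ... | inj₂ y<x = x≤y y<x

  ⊓-lowerˡ : x ≤ y ⊓ z → x ≤ y
  ⊓-lowerˡ {y = y} {z} x≤y⊓z = ≤-trans x≤y⊓z (proj₁ (⊓-infimum y z))

  ⊓-lowerʳ : x ≤ y ⊓ z → x ≤ z
  ⊓-lowerʳ {y = y} {z} x≤y⊓z = ≤-trans x≤y⊓z (proj₁ (proj₂ (⊓-infimum y z)))

  ⊔-upperˡ : x ⊔ y < z → x ≤ z
  ⊔-upperˡ {x} {y} x⊔y<z = ≤-trans (proj₁ (⊔-supremum x y)) (<⇒≤ x⊔y<z)

  ⊔-upperʳ : x ⊔ y < z → y ≤ z
  ⊔-upperʳ {x} {y} x⊔y<z = ≤-trans (proj₁ (proj₂ (⊔-supremum x y))) (<⇒≤ x⊔y<z)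

  x<y⇒0<y-x : x < y → 0# < y - x
  x<y⇒0<y-x {x} {y} x<y =
    <-respˡ (solve 1 (λ x → :- x :+ x := con (+ 0)) refl x)
      (<-respʳ (solve 2 (λ x y → :- x :+ y := y :- x) refl x y) (+-monoʳ-< (- x) x<y))

  0<y-x⇒x<y : 0# < y - x → x < y
  0<y-x⇒x<y {y} {x} 0<y-x =
    <-respˡ (+-identityʳ x)
      (<-respʳ (solve 2 (λ x y → x :+ (y :- x) := y) refl x y) (+-monoʳ-< x 0<y-x))

  x<0⇒0<-x : x < 0# → 0# < - x
  x<0⇒0<-x {x} x<0 = <-respʳ (+-identityˡ (- x)) (x<y⇒0<y-x x<0)

  x≤y⇒0≤y-x : x ≤ y → 0# ≤ y - x
  x≤y⇒0≤y-x {x} {y} x≤y y-x<0 = x≤y (0<y-x⇒x<y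
    (<-respʳ (solve 2 (λ x y → :- (y :- x) := x :- y) refl x y) (x<0⇒0<-x y-x<0)))

  0≤y-x⇒x≤y : 0# ≤ y - x → x ≤ y
  0≤y-x⇒x≤y {y} {x} 0≤y-x y<x = 0≤y-x (0<y-x⇒x<y
    (<-respʳ (solve 2 (λ x y → x :- y := con (+ 0) :- (y :- x)) refl x y) (x<y⇒0<y-x y<x)))

  +-nonneg : 0# ≤ x → 0# ≤ y → 0# ≤ x + y
  +-nonneg {x} {y} 0≤x 0≤y x+y<0 with <-cotrans x+y<0 y
  ... | inj₂ y<0   = 0≤y y<0
  ... | inj₁ x+y<y = 0≤x (0<y-x⇒x<y
    (<-respʳ (solve 2 (λ x y → y :- (x :+ y) := con (+ 0) :- x) refl x y) (x<y⇒0<y-x x+y<y)))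

  -- Suppose the product is negative. If `x` were positive, `y` could be neither positive nor
  -- negative, so the product would be zero; hence `x` itself is zero, and so is the product.
  *-nonneg : 0# ≤ x → 0# ≤ y → 0# ≤ x * y
  *-nonneg {x} {y} 0≤x 0≤y xy<0 = <-irrefl x*y≈0 xy<0
    where
    x≤0 : x ≤ 0#
    x≤0 0<x = <-irrefl (trans (*-congˡ (≤-antisym y≤0 0≤y)) (zeroʳ x)) xy<0
      where
      y≤0 : y ≤ 0#
      y≤0 0<y = <⇒≤ (*-pos 0<x 0<y) xy<0

    x*y≈0 : x * y ≈ 0#
    x*y≈0 = trans (*-congʳ (≤-antisym x≤0 0≤x)) (zeroˡ y)

  square-pos : x # 0# → 0# < x * x
  square-pos     (inj₂ 0<x) = *-pos 0<x 0<x
  square-pos {x} (inj₁ x<0) = <-respʳ (solve 1 (λ x → :- x :* :- x := x :* x) refl x)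
    (*-pos (x<0⇒0<-x x<0) (x<0⇒0<-x x<0))

  square-nonneg : ∀ x → 0# ≤ x * x
  square-nonneg x xx<0 = <-irrefl (trans (*-congʳ x≈0) (zeroˡ x)) xx<0
    where
    x≈0 : x ≈ 0#
    x≈0 = proj₁ (tight x 0#) (λ x#0 → <⇒≤ (square-pos x#0) xx<0)

  positive*square≤0⇒≈0 : ∀ y x ⦃ _ : Positive y ⦄ → y * (x * x) ≤ 0# → x ≈ 0#
  positive*square≤0⇒≈0 y x ⦃ positive 0<y ⦄ yxx≤0 =
    proj₁ (tight x 0#) (λ x#0 → yxx≤0 (*-pos 0<y (square-pos x#0)))

  -- Path flows and slacks below contain an inverse; their signs are checked after multiplication by
  -- the denominator.
  *-cancelˡ-0≤ : ∀ x ⦃ _ : Positive x ⦄ → 0# ≤ x * y → 0# ≤ y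
  *-cancelˡ-0≤ {y} x ⦃ positive 0<x ⦄ 0≤xy y<0 = 0≤xy (0<y-x⇒x<y
    (<-respʳ (solve 2 (λ x y → x :* :- y := con (+ 0) :- x :* y) refl x y)
      (*-pos 0<x (x<0⇒0<-x y<0))))

  *-cancelˡ-≈0 : ∀ x ⦃ _ : Positive x ⦄ → x * y ≈ 0# → y ≈ 0#
  *-cancelˡ-≈0 {y} x xy≈0 = begin
    y                ≈⟨ *-identityʳ y ⟨
    y * 1#           ≈⟨ *-congˡ (⁻¹-inverseʳ x) ⟨
    y * (x * x ⁻¹)   ≈⟨ solve 3 (λ x i y → y :* (x :* i) := x :* y :* i) refl x (x ⁻¹) y ⟩
    x * y * x ⁻¹     ≈⟨ *-congʳ xy≈0 ⟩
    0# * x ⁻¹        ≈⟨ zeroˡ (x ⁻¹) ⟩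
    0#               ∎

  x/y*y≈x : ∀ x y ⦃ _ : Positive y ⦄ → x / y * y ≈ x
  x/y*y≈x x y = begin
    x * y ⁻¹ * y    ≈⟨ solve 3 (λ x y i → x :* i :* y := x :* (y :* i)) refl x y (y ⁻¹) ⟩
    x * (y * y ⁻¹)  ≈⟨ *-congˡ (⁻¹-inverseʳ y) ⟩
    x * 1#          ≈⟨ *-identityʳ x ⟩
    x               ∎

  z*[x/z-y]≈x-yz : ∀ x y z ⦃ _ : Positive z ⦄ → z * (x / z - y) ≈ x - y * z
  z*[x/z-y]≈x-yz x y z = begin
    z * (x / z - y)  ≈⟨ solve 3 (λ q y z → z :* (q :- y) := q :* z :- y :* z) refl (x / z) y z ⟩
    x / z * z - y * z  ≈⟨ +-congʳ (x/y*y≈x x z) ⟩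
    x - y * z  ∎

  -- Divisions in hypotheses are cleared into `0# ≤ _`, the form in which
  -- inequalities combine with ring identities.
  y≤x/z⇒0≤x-yz : ∀ ⦃ _ : Positive z ⦄ → y ≤ x / z → 0# ≤ x - y * z
  y≤x/z⇒0≤x-yz {z} {y} {x} y≤x/z =
    ≤-respʳ (z*[x/z-y]≈x-yz x y z) (*-nonneg (positive⇒0≤ z) (x≤y⇒0≤y-x y≤x/z))

  x/z≤y⇒0≤yz-x : ∀ ⦃ _ : Positive z ⦄ → x / z ≤ y → 0# ≤ y * z - x
  x/z≤y⇒0≤yz-x {z} {x} {y} x/z≤y =
    ≤-respʳ eq (*-nonneg (positive⇒0≤ z) (x≤y⇒0≤y-x x/z≤y))
    where
    eq : z * (y - x / z) ≈ y * z - x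
    eq = begin
      z * (y - x / z)         ≈⟨ solve 3 (λ q y z → z :* (y :- q) := :- (z :* (q :- y))) refl (x / z) y z ⟩
      - (z * (x / z - y))     ≈⟨ -‿cong (z*[x/z-y]≈x-yz x y z) ⟩
      - (x - y * z)           ≈⟨ solve 2 (λ x w → :- (x :- w) := w :- x) refl x (y * z) ⟩
      y * z - x               ∎

  -- `m` is the cofactor of the relation `x ≈ y` in a ring identity for `a - b`.
  modulo : ∀ {a b} m → x ≈ y → a ≈ b + m * (x - y) → a ≈ b
  modulo {x} {y} {a} {b} m x≈y a≈ = begin
    a                ≈⟨ a≈ ⟩
    b + m * (x - y)  ≈⟨ +-congˡ (*-congˡ (trans (+-congʳ x≈y) (-‿inverseʳ y))) ⟩
    b + m * 0#       ≈⟨ +-congˡ (zeroʳ m) ⟩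
    b + 0#           ≈⟨ +-identityʳ b ⟩
    b                ∎

-- Path travel times as polynomials in the parameters and path flows.

module NetworkProperties {c ℓ₁ ℓ₂} (ℝ : Reals c ℓ₁ ℓ₂) (N : Network ℝ) where
  open Reals ℝ
  open Network N
  open OrderedFieldProperties orderedField

  private
    module _ {n : ℕ} where
      :0 : Polynomial n
      :0 = con (+ 0)

      -- `time₁`–`time₃` mirror the normal form of `pathTime f p`, including the
      -- zeros that end each `sum`, so that `solve` matches goals definitionally.
      time₁ : (a₁ a₂ b₁ b₂ x z : Polynomial n) → Polynomial n
      time₁ a₁ a₂ b₁ b₂ x z =
        (a₁ :+ b₁ :* (x :+ (z :+ :0))) :+ ((a₂ :+ b₂ :* (x :+ :0)) :+ :0)

      time₂ : (a₄ a₅ b₄ b₅ y z : Polynomial n) → Polynomial n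
      time₂ a₄ a₅ b₄ b₅ y z =
        (a₄ :+ b₄ :* (y :+ :0)) :+ ((a₅ :+ b₅ :* (y :+ (z :+ :0))) :+ :0)

      time₃ : (a₁ a₃ a₅ b₁ b₃ b₅ x y z : Polynomial n) → Polynomial n
      time₃ a₁ a₃ a₅ b₁ b₃ b₅ x y z =
        (a₁ :+ b₁ :* (x :+ (z :+ :0)))
          :+ ((a₃ :+ b₃ :* (z :+ :0)) :+ ((a₅ :+ b₅ :* (y :+ (z :+ :0))) :+ :0))

  -- Complementarity and uniqueness of the equilibrium.

  module _ {Q : Carrier} {f : Path → Carrier} {T : Carrier} (eq : IsEquilibrium Q f T) where
    open IsEquilibrium eq
    open IsFlow isFlow

    -- A path faster than `T` could not have vanishing flow, but then its time would be `T`.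
    time-bound : ∀ p → T ≤ pathTime f p
    time-bound p t<T = <-irrefl refl (<-respˡ (nonVanishing p fp≉0) t<T)
      where
      fp≉0 : ¬ (f p ≈ 0#)
      fp≉0 fp≈0 = vanishing p fp≈0 t<T

    -- If the product were nonzero, so would be `f p`, which makes the other factor zero. As an
    -- equation, the equilibrium condition can enter ring identities through `modulo`.
    complementary : ∀ p → f p * (pathTime f p - T) ≈ 0#
    complementary p = ≈-stable λ ≉0 → ≉0
      (trans (*-congˡ (trans (+-congʳ (nonVanishing p (λ fp≈0 → ≉0 (trans (*-congʳ fp≈0) (zeroˡ _))))) (-‿inverseʳ T)))
             (zeroʳ (f p)))

  -- By complementarity the bound equals f p (t′ p - T′) + f′ p (t p - T).
  pathwise-monotone : ∀ {Q f f′ T T′} → IsEquilibrium Q f T → IsEquilibrium Q f′ T′ → ∀ p →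
    0# ≤ (f p - f′ p) * (T - T′) - (f p - f′ p) * (pathTime f p - pathTime f′ p)
  pathwise-monotone {f = f} {f′} {T} {T′} eq eq′ p =
    ≤-respʳ
      (modulo 1# (complementary eq p) (modulo 1# (complementary eq′ p)
        (solve 6 (λ x x′ t t′ T T′ →
          x :* (t′ :- T′) :+ x′ :* (t :- T) :=
          (x :- x′) :* (T :- T′) :- (x :- x′) :* (t :- t′)
            :+ con (+ 1) :* (x :* (t :- T) :- con (+ 0))
            :+ con (+ 1) :* (x′ :* (t′ :- T′) :- con (+ 0)))
          refl (f p) (f′ p) (pathTime f p) (pathTime f′ p) T T′)))
      (+-nonneg
        (*-nonneg (IsFlow.nonneg (IsEquilibrium.isFlow eq) p) (x≤y⇒0≤y-x (time-bound eq′ p)))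
        (*-nonneg (IsFlow.nonneg (IsEquilibrium.isFlow eq′) p) (x≤y⇒0≤y-x (time-bound eq p))))

  module _ (f f′ : Path → Carrier) where
    private
      d : Path → Carrier
      d p = f p - f′ p

    -- The constants `αₗ` cancel, which leaves a form linear in the link flow differences.
    time-difference₁ : pathTime f P₁ - pathTime f′ P₁ ≈ β₁ * (d P₁ + d P₃) + β₂ * d P₁
    time-difference₁ = solve 8
      (λ a₁ a₂ b₁ b₂ x z x′ z′ →
        time₁ a₁ a₂ b₁ b₂ x z :- time₁ a₁ a₂ b₁ b₂ x′ z′ :=
        b₁ :* ((x :- x′) :+ (z :- z′)) :+ b₂ :* (x :- x′))
      refl α₁ α₂ β₁ β₂ (f P₁) (f P₃) (f′ P₁) (f′ P₃)

    time-difference₂ : pathTime f P₂ - pathTime f′ P₂ ≈ β₄ * d P₂ + β₅ * (d P₂ + d P₃)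
    time-difference₂ = solve 8
      (λ a₄ a₅ b₄ b₅ y z y′ z′ →
        time₂ a₄ a₅ b₄ b₅ y z :- time₂ a₄ a₅ b₄ b₅ y′ z′ :=
        b₄ :* (y :- y′) :+ b₅ :* ((y :- y′) :+ (z :- z′)))
      refl α₄ α₅ β₄ β₅ (f P₂) (f P₃) (f′ P₂) (f′ P₃)

    time-difference₃ : pathTime f P₃ - pathTime f′ P₃ ≈
                       β₁ * (d P₁ + d P₃) + β₃ * d P₃ + β₅ * (d P₂ + d P₃)
    time-difference₃ = solve 12
      (λ a₁ a₃ a₅ b₁ b₃ b₅ x y z x′ y′ z′ →
        time₃ a₁ a₃ a₅ b₁ b₃ b₅ x y z :- time₃ a₁ a₃ a₅ b₁ b₃ b₅ x′ y′ z′ :=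
        b₁ :* ((x :- x′) :+ (z :- z′)) :+ b₃ :* (z :- z′) :+ b₅ :* ((y :- y′) :+ (z :- z′)))
      refl α₁ α₃ α₅ β₁ β₃ β₅ (f P₁) (f P₂) (f P₃) (f′ P₁) (f′ P₂) (f′ P₃)

  module _ {Q : Carrier} {f f′ : Path → Carrier} {T T′ : Carrier}
           (eq : IsEquilibrium Q f T) (eq′ : IsEquilibrium Q f′ T′) where
    private
      d δ : Path → Carrier
      d p = f p - f′ p
      δ p = pathTime f p - pathTime f′ p

      -- The terms βₗ dₗ² of the quadratic form; `ab` and `cd` each lie on two paths, so their flow
      -- differences are sums.
      E : (l : Link) → Carrier
      E ab = β₁ * ((d P₁ + d P₃) * (d P₁ + d P₃))
      E bd = β₂ * (d P₁ * d P₁)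
      E bc = β₃ * (d P₃ * d P₃)
      E ac = β₄ * (d P₂ * d P₂)
      E cd = β₅ * ((d P₂ + d P₃) * (d P₂ + d P₃))

      0≤E : ∀ l → 0# ≤ E l
      0≤E ab = *-nonneg (positive⇒0≤ β₁) (square-nonneg _)
      0≤E bd = *-nonneg (positive⇒0≤ β₂) (square-nonneg _)
      0≤E bc = *-nonneg (positive⇒0≤ β₃) (square-nonneg _)
      0≤E ac = *-nonneg (positive⇒0≤ β₄) (square-nonneg _)
      0≤E cd = *-nonneg (positive⇒0≤ β₅) (square-nonneg _)

      Σd≈0 : d P₁ + d P₂ + d P₃ ≈ 0#
      Σd≈0 = modulo 1# (trans (IsFlow.total (IsEquilibrium.isFlow eq))
                              (sym (IsFlow.total (IsEquilibrium.isFlow eq′))))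
        (solve 6 (λ x y z x′ y′ z′ →
          (x :- x′) :+ (y :- y′) :+ (z :- z′) :=
          con (+ 0) :+ con (+ 1) :* ((x :+ (y :+ (z :+ con (+ 0)))) :- (x′ :+ (y′ :+ (z′ :+ con (+ 0))))))
          refl (f P₁) (f P₂) (f P₃) (f′ P₁) (f′ P₂) (f′ P₃))

      -- Sum `pathwise-monotone` over the paths. The terms in `T - T′` cancel because both flows
      -- have total `Q`, and regrouping Σ `d p * δ p` by links gives the sum of the `E l`.
      0≤-ΣE : 0# ≤ - (E ab + E bd + E bc + E ac + E cd)
      0≤-ΣE = ≤-respʳ
        (modulo (T - T′) Σd≈0
          (modulo (- d P₁) (time-difference₁ f f′)
          (modulo (- d P₂) (time-difference₂ f f′)
          (modulo (- d P₃) (time-difference₃ f f′)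
          (solve 12 (λ b₁ b₂ b₃ b₄ b₅ x y z s t u U →
            (x :* U :- x :* s) :+ (y :* U :- y :* t) :+ (z :* U :- z :* u) :=
            :- (b₁ :* ((x :+ z) :* (x :+ z)) :+ b₂ :* (x :* x) :+ b₃ :* (z :* z)
                :+ b₄ :* (y :* y) :+ b₅ :* ((y :+ z) :* (y :+ z)))
              :+ U :* (x :+ y :+ z :- con (+ 0))
              :+ :- x :* (s :- (b₁ :* (x :+ z) :+ b₂ :* x))
              :+ :- y :* (t :- (b₄ :* y :+ b₅ :* (y :+ z)))
              :+ :- z :* (u :- (b₁ :* (x :+ z) :+ b₃ :* z :+ b₅ :* (y :+ z))))
            refl β₁ β₂ β₃ β₄ β₅ (d P₁) (d P₂) (d P₃) (δ P₁) (δ P₂) (δ P₃) (T - T′))))))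
        (+-nonneg (+-nonneg (pathwise-monotone eq eq′ P₁) (pathwise-monotone eq eq′ P₂))
                  (pathwise-monotone eq eq′ P₃))

      -- Applied with `y` the sum of all `E l` and `x` one of its terms, so that `y - x` collects
      -- the other, non-negative terms.
      0≤rest⇒≤0 : ∀ {x y} → 0# ≤ - y → 0# ≤ y - x → x ≤ 0#
      0≤rest⇒≤0 {x} {y} 0≤-y 0≤y-x = 0≤y-x⇒x≤y
        (≤-respʳ (solve 2 (λ x y → :- y :+ (y :- x) := con (+ 0) :- x) refl x y) (+-nonneg 0≤-y 0≤y-x))

      difference-vanishes : ∀ p → d p ≈ 0#
      difference-vanishes P₁ = positive*square≤0⇒≈0 β₂ (d P₁) (0≤rest⇒≤0 0≤-ΣE
        (≤-respʳ (solve 5 (λ a b c d e → a :+ c :+ d :+ e := a :+ b :+ c :+ d :+ e :- b) refl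
                   (E ab) (E bd) (E bc) (E ac) (E cd))
          (+-nonneg (+-nonneg (+-nonneg (0≤E ab) (0≤E bc)) (0≤E ac)) (0≤E cd))))
      difference-vanishes P₂ = positive*square≤0⇒≈0 β₄ (d P₂) (0≤rest⇒≤0 0≤-ΣE
        (≤-respʳ (solve 5 (λ a b c d e → a :+ b :+ c :+ e := a :+ b :+ c :+ d :+ e :- d) refl
                   (E ab) (E bd) (E bc) (E ac) (E cd))
          (+-nonneg (+-nonneg (+-nonneg (0≤E ab) (0≤E bd)) (0≤E bc)) (0≤E cd))))
      difference-vanishes P₃ = positive*square≤0⇒≈0 β₃ (d P₃) (0≤rest⇒≤0 0≤-ΣE
        (≤-respʳ (solve 5 (λ a b c d e → a :+ b :+ d :+ e := a :+ b :+ c :+ d :+ e :- c) refl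
                   (E ab) (E bd) (E bc) (E ac) (E cd))
          (+-nonneg (+-nonneg (+-nonneg (0≤E ab) (0≤E bd)) (0≤E ac)) (0≤E cd))))

    equilibrium-flow-unique : ∀ p → f p ≈ f′ p
    equilibrium-flow-unique p = modulo 1# (difference-vanishes p)
      (solve 2 (λ x y → x := y :+ con (+ 1) :* (x :- y :- con (+ 0))) refl (f p) (f′ p))

  sum-cong : ∀ {f g : Path → Carrier} → (∀ p → f p ≈ g p) → ∀ ps → sum (map f ps) ≈ sum (map g ps)
  sum-cong f≈g []       = refl
  sum-cong f≈g (p ∷ ps) = +-cong (f≈g p) (sum-cong f≈g ps)

  -- For a concrete link the `filter` in `linkFlow` evaluates to the list of paths through it.
  linkFlow-cong : ∀ {f g} → (∀ p → f p ≈ g p) → ∀ l → linkFlow f l ≈ linkFlow g l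
  linkFlow-cong f≈g ab = sum-cong f≈g (P₁ ∷ P₃ ∷ [])
  linkFlow-cong f≈g bd = sum-cong f≈g (P₁ ∷ [])
  linkFlow-cong f≈g bc = sum-cong f≈g (P₃ ∷ [])
  linkFlow-cong f≈g ac = sum-cong f≈g (P₂ ∷ [])
  linkFlow-cong f≈g cd = sum-cong f≈g (P₂ ∷ P₃ ∷ [])

  pathTime-cong : ∀ {f g} → (∀ p → f p ≈ g p) → ∀ p → pathTime f p ≈ pathTime g p
  pathTime-cong {f} {g} f≈g p = go (links p)
    where
    go : ∀ ls → sum (map (linkTime f) ls) ≈ sum (map (linkTime g) ls)
    go []       = refl
    go (l ∷ ls) = +-cong (+-congˡ (*-congˡ (linkFlow-cong f≈g l))) (go ls)

  -- A used path cannot be singled out without deciding equality; the negated form suffices, since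
  -- it is applied towards a stable conclusion.
  some-path-used : ∀ Q ⦃ _ : Positive Q ⦄ {f} → IsFlow Q f → ¬ (∀ p → f p ≈ 0#)
  some-path-used Q ⦃ positive 0<Q ⦄ {f} isFlow f≈0 =
    <-irrefl (trans (sym 0+0+0≈0) (trans (sum-cong (λ p → sym (f≈0 p)) paths) (IsFlow.total isFlow))) 0<Q
    where
    0+0+0≈0 : 0# + (0# + (0# + 0#)) ≈ 0#
    0+0+0≈0 = trans (+-identityˡ _) (trans (+-identityˡ _) (+-identityˡ 0#))

  -- If `T` and `T′` differed, no path could carry flow: it would have time `T` under `f` and `T′`
  -- under `f′`, although the two flows agree.
  equilibrium-time-unique : ∀ Q ⦃ _ : Positive Q ⦄ {f f′ T T′} →
    IsEquilibrium Q f T → IsEquilibrium Q f′ T′ → T ≈ T′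
  equilibrium-time-unique Q {f} {f′} {T} {T′} eq eq′ = ≈-stable λ T≉T′ →
    some-path-used Q (IsEquilibrium.isFlow eq) λ p → ≈-stable λ fp≉0 → T≉T′
      (trans (sym (IsEquilibrium.nonVanishing eq p fp≉0))
        (trans (pathTime-cong f≈f′ p)
          (IsEquilibrium.nonVanishing eq′ p (λ f′p≈0 → fp≉0 (trans (f≈f′ p) f′p≈0)))))
    where
    f≈f′ = equilibrium-flow-unique eq eq′

  -- Certificates for an equilibrium.

  -- Here `s` is the excess of a path's time over `T`. Since `tight` also admits `x ≈ 0#`, a path
  -- whose flow just reaches zero at the end of a range of `Q` is no special case.
  data Complementary (x s : Carrier) : Set (c Level.⊔ ℓ₁ Level.⊔ ℓ₂) where
    tight : s ≈ 0# → Complementary x s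
    slack : x ≈ 0# → 0# ≤ s → Complementary x s

  flow : (x y z : Carrier) → Path → Carrier
  flow x y z P₁ = x
  flow x y z P₂ = y
  flow x y z P₃ = z

  -- Leaves, for each range of `Q`, only ring identities and sign conditions on three explicit path
  -- flows.
  T⁺Eq-from-flow : ∀ {Q} ⦃ _ : Positive Q ⦄ {T} x y z →
    let f = flow x y z in
    0# ≤ x → 0# ≤ y → 0# ≤ z → x + y + z ≈ Q →
    Complementary x (pathTime f P₁ - T) →
    Complementary y (pathTime f P₂ - T) →
    Complementary z (pathTime f P₃ - T) →
    T⁺Eq[ Q ]≈ T
  T⁺Eq-from-flow {Q} {T} x y z 0≤x 0≤y 0≤z x+y+z≈Q c₁ c₂ c₃ =
    (f , equilibrium) , λ f′ T′ eq′ → equilibrium-time-unique Q eq′ equilibrium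
    where
    f : Path → Carrier
    f = flow x y z

    0≤f : ∀ p → 0# ≤ f p
    0≤f P₁ = 0≤x
    0≤f P₂ = 0≤y
    0≤f P₃ = 0≤z

    complementary-f : ∀ p → Complementary (f p) (pathTime f p - T)
    complementary-f P₁ = c₁
    complementary-f P₂ = c₂
    complementary-f P₃ = c₃

    t≈T : ∀ {t} → t - T ≈ 0# → t ≈ T
    t≈T {t} t-T≈0 = modulo 1# t-T≈0
      (solve 2 (λ t T → t := T :+ con (+ 1) :* (t :- T :- con (+ 0))) refl t T)

    equilibrium : IsEquilibrium Q f T
    equilibrium = record
      { isFlow = record
        { nonneg = 0≤f
        ; total  = trans (solve 3 (λ x y z → x :+ (y :+ (z :+ con (+ 0))) := x :+ y :+ z) refl x y z) x+y+z≈Q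
        }
      ; nonVanishing = λ p fp≉0 → nonVanishing-f p fp≉0 (complementary-f p)
      ; vanishing    = λ p _ → bound-f p (complementary-f p)
      }
      where
      nonVanishing-f : ∀ p → ¬ (f p ≈ 0#) → Complementary (f p) (pathTime f p - T) → pathTime f p ≈ T
      nonVanishing-f p fp≉0 (tight s≈0)    = t≈T s≈0
      nonVanishing-f p fp≉0 (slack fp≈0 _) = ⊥-elim (fp≉0 fp≈0)

      bound-f : ∀ p → Complementary (f p) (pathTime f p - T) → T ≤ pathTime f p
      bound-f p (tight s≈0)   = 0≤y-x⇒x≤y (≤-reflexive (sym s≈0))
      bound-f p (slack _ 0≤s) = 0≤y-x⇒x≤y 0≤s

  -- The equilibrium in each range of `Q`.

  module _ (Q : Carrier) ⦃ Q-pos : Positive Q ⦄ where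

    -- With all traffic on `P₃`, the excess times of `P₁` and `P₂` are `α̂ - Q * β₃₅` and
    -- `ᾱ - Q * β₁₃`: the two bounds in the minimum.
    time-only-P₃ : Q ≤ (α̂ / β₃₅) ⊓ (ᾱ / β₁₃) → T⁺Eq[ Q ]≈ α₁₃₅ + Q * β₁₃₅
    time-only-P₃ Q≤ = T⁺Eq-from-flow 0# 0# Q ≤-refl ≤-refl (positive⇒0≤ Q)
      (solve 1 (λ Q → :0 :+ :0 :+ Q := Q) refl Q)
      (slack refl (≤-respʳ
        (solve 9 (λ a₁ a₂ a₃ a₅ b₁ b₂ b₃ b₅ Q →
          a₂ :- (a₃ :+ a₅) :- Q :* (b₃ :+ b₅) :=
          time₁ a₁ a₂ b₁ b₂ :0 Q :- (a₁ :+ a₃ :+ a₅ :+ Q :* (b₁ :+ b₃ :+ b₅)))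
          refl α₁ α₂ α₃ α₅ β₁ β₂ β₃ β₅ Q)
        (y≤x/z⇒0≤x-yz (⊓-lowerˡ Q≤))))
      (slack refl (≤-respʳ
        (solve 9 (λ a₁ a₃ a₄ a₅ b₁ b₃ b₄ b₅ Q →
          a₄ :- (a₁ :+ a₃) :- Q :* (b₁ :+ b₃) :=
          time₂ a₄ a₅ b₄ b₅ :0 Q :- (a₁ :+ a₃ :+ a₅ :+ Q :* (b₁ :+ b₃ :+ b₅)))
          refl α₁ α₃ α₄ α₅ β₁ β₃ β₄ β₅ Q)
        (y≤x/z⇒0≤x-yz (⊓-lowerʳ Q≤))))
      (tight (solve 7 (λ a₁ a₃ a₅ b₁ b₃ b₅ Q →
          time₃ a₁ a₃ a₅ b₁ b₃ b₅ :0 :0 Q :- (a₁ :+ a₃ :+ a₅ :+ Q :* (b₁ :+ b₃ :+ b₅)) := :0)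
          refl α₁ α₃ α₅ β₁ β₃ β₅ Q))

    time-only-P₂ : Q ≤ (- α / β₄₅) ⊓ (- ᾱ / β₄) → T⁺Eq[ Q ]≈ α₄₅ + Q * β₄₅
    time-only-P₂ Q≤ = T⁺Eq-from-flow 0# Q 0# ≤-refl (positive⇒0≤ Q) ≤-refl
      (solve 1 (λ Q → :0 :+ Q :+ :0 := Q) refl Q)
      (slack refl (≤-respʳ
        (solve 9 (λ a₁ a₂ a₄ a₅ b₁ b₂ b₄ b₅ Q →
          :- (a₄ :+ a₅ :- (a₁ :+ a₂)) :- Q :* (b₄ :+ b₅) :=
          time₁ a₁ a₂ b₁ b₂ :0 :0 :- (a₄ :+ a₅ :+ Q :* (b₄ :+ b₅)))
          refl α₁ α₂ α₄ α₅ β₁ β₂ β₄ β₅ Q)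
        (y≤x/z⇒0≤x-yz (⊓-lowerˡ Q≤))))
      (tight (solve 5 (λ a₄ a₅ b₄ b₅ Q →
          time₂ a₄ a₅ b₄ b₅ Q :0 :- (a₄ :+ a₅ :+ Q :* (b₄ :+ b₅)) := :0)
          refl α₄ α₅ β₄ β₅ Q))
      (slack refl (≤-respʳ
        (solve 9 (λ a₁ a₃ a₄ a₅ b₁ b₃ b₄ b₅ Q →
          :- (a₄ :- (a₁ :+ a₃)) :- Q :* b₄ :=
          time₃ a₁ a₃ a₅ b₁ b₃ b₅ :0 Q :0 :- (a₄ :+ a₅ :+ Q :* (b₄ :+ b₅)))
          refl α₁ α₃ α₄ α₅ β₁ β₃ β₄ β₅ Q)
        (y≤x/z⇒0≤x-yz (⊓-lowerʳ Q≤))))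

    -- Mirror image of `time-only-P₂`: reversing the network exchanges the indices 1 with 5 and 2
    -- with 4, hence `ᾱ` with `α̂` and `α` with `- α`.
    time-only-P₁ : Q ≤ (α / β₁₂) ⊓ (- α̂ / β₂) → T⁺Eq[ Q ]≈ α₁₂ + Q * β₁₂
    time-only-P₁ Q≤ = T⁺Eq-from-flow Q 0# 0# (positive⇒0≤ Q) ≤-refl ≤-refl
      (solve 1 (λ Q → Q :+ :0 :+ :0 := Q) refl Q)
      (tight (solve 5 (λ a₁ a₂ b₁ b₂ Q →
          time₁ a₁ a₂ b₁ b₂ Q :0 :- (a₁ :+ a₂ :+ Q :* (b₁ :+ b₂)) := :0)
          refl α₁ α₂ β₁ β₂ Q))
      (slack refl (≤-respʳ
        (solve 9 (λ a₁ a₂ a₄ a₅ b₁ b₂ b₄ b₅ Q →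
          a₄ :+ a₅ :- (a₁ :+ a₂) :- Q :* (b₁ :+ b₂) :=
          time₂ a₄ a₅ b₄ b₅ :0 :0 :- (a₁ :+ a₂ :+ Q :* (b₁ :+ b₂)))
          refl α₁ α₂ α₄ α₅ β₁ β₂ β₄ β₅ Q)
        (y≤x/z⇒0≤x-yz (⊓-lowerˡ Q≤))))
      (slack refl (≤-respʳ
        (solve 9 (λ a₁ a₂ a₃ a₅ b₁ b₂ b₃ b₅ Q →
          :- (a₂ :- (a₃ :+ a₅)) :- Q :* b₂ :=
          time₃ a₁ a₃ a₅ b₁ b₃ b₅ Q :0 :0 :- (a₁ :+ a₂ :+ Q :* (b₁ :+ b₂)))
          refl α₁ α₂ α₃ α₅ β₁ β₂ β₃ β₅ Q)
        (y≤x/z⇒0≤x-yz (⊓-lowerʳ Q≤))))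

    -- The flow `z` on `P₃` solves α₄ + β₄ (Q - z) = α₁₃ + β₁₃ z, which equalises the two ways from
    -- a to c. The two terms of the maximum say that `Q - z` and `z` are non-negative.
    time-P₂-P₃ : (ᾱ / β₁₃) ⊔ (- ᾱ / β₄) < Q → Q ≤ μ₁ →
             T⁺Eq[ Q ]≈ α₄₅ + Q * β₄₅ - (ᾱ + Q * β₄) * β₄ / β₁₃₄
    time-P₂-P₃ max<Q Q≤μ₁ = T⁺Eq-from-flow 0# (Q - z) z ≤-refl
      (*-cancelˡ-0≤ β₁₃₄ (≤-respʳ
        (sym (modulo (- n) (⁻¹-inverseʳ β₁₃₄)
          (solve 6 (λ ᾱ b₁ b₃ b₄ Q i →
            let n = ᾱ :+ Q :* b₄ ; b₁₃₄ = b₁ :+ b₃ :+ b₄ in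
            b₁₃₄ :* (Q :- n :* i) :=
            Q :* (b₁ :+ b₃) :- ᾱ :+ :- n :* (b₁₃₄ :* i :- con (+ 1)))
            refl ᾱ β₁ β₃ β₄ Q i)))
        (x/z≤y⇒0≤yz-x (⊔-upperˡ max<Q))))
      (*-cancelˡ-0≤ β₁₃₄ (≤-respʳ
        (sym (modulo n (⁻¹-inverseʳ β₁₃₄)
          (solve 6 (λ ᾱ b₁ b₃ b₄ Q i →
            let n = ᾱ :+ Q :* b₄ ; b₁₃₄ = b₁ :+ b₃ :+ b₄ in
            b₁₃₄ :* (n :* i) :=
            Q :* b₄ :- :- ᾱ :+ n :* (b₁₃₄ :* i :- con (+ 1)))
            refl ᾱ β₁ β₃ β₄ Q i)))
        (x/z≤y⇒0≤yz-x (⊔-upperʳ max<Q))))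
      (solve 2 (λ Q z → :0 :+ (Q :- z) :+ z := Q) refl Q z)
      -- Times `β₁₃₄`, the excess time of `P₁` is the numerator of `μ₁` minus `Q` times its
      -- denominator.
      (slack refl (*-cancelˡ-0≤ β₁₃₄ (≤-respʳ
        (sym (modulo (β₁₄ * n) (⁻¹-inverseʳ β₁₃₄)
          (solve 12 (λ a₁ a₂ a₃ a₄ a₅ b₁ b₂ b₃ b₄ b₅ Q i →
            let n = a₄ :- (a₁ :+ a₃) :+ Q :* b₄ ; b₁₃₄ = b₁ :+ b₃ :+ b₄
                b₁₄ = b₁ :+ b₄ ; b₄₅ = b₄ :+ b₅
                α = a₄ :+ a₅ :- (a₁ :+ a₂) ; α̂ = a₂ :- (a₃ :+ a₅) in
            b₁₃₄ :* (time₁ a₁ a₂ b₁ b₂ :0 (n :* i)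
                     :- (a₄ :+ a₅ :+ Q :* b₄₅ :- n :* b₄ :* i)) :=
            α̂ :* b₁₄ :- α :* b₃ :- Q :* (b₃ :* b₄₅ :+ b₅ :* b₁₄)
              :+ b₁₄ :* n :* (b₁₃₄ :* i :- con (+ 1)))
            refl α₁ α₂ α₃ α₄ α₅ β₁ β₂ β₃ β₄ β₅ Q i)))
        (y≤x/z⇒0≤x-yz Q≤μ₁))))
      -- An identity for arbitrary `n` and `i`: the claimed time is that of `P₂` when `ac` carries
      -- `Q - z` and `cd` carries `Q`.
      (tight (solve 7 (λ a₄ a₅ b₄ b₅ Q n i →
        time₂ a₄ a₅ b₄ b₅ (Q :- n :* i) (n :* i)
          :- (a₄ :+ a₅ :+ Q :* (b₄ :+ b₅) :- n :* b₄ :* i) := :0)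
        refl α₄ α₅ β₄ β₅ Q n i))
      (tight (modulo n (⁻¹-inverseʳ β₁₃₄)
        (solve 10 (λ a₁ a₃ a₄ a₅ b₁ b₃ b₄ b₅ Q i →
          let n = a₄ :- (a₁ :+ a₃) :+ Q :* b₄ ; b₁₃₄ = b₁ :+ b₃ :+ b₄ in
          time₃ a₁ a₃ a₅ b₁ b₃ b₅ :0 (Q :- n :* i) (n :* i)
            :- (a₄ :+ a₅ :+ Q :* (b₄ :+ b₅) :- n :* b₄ :* i) :=
          :0 :+ n :* (b₁₃₄ :* i :- con (+ 1)))
          refl α₁ α₃ α₄ α₅ β₁ β₃ β₄ β₅ Q i)))
      where
      i n z : Carrier
      i = β₁₃₄ ⁻¹
      n = ᾱ + Q * β₄
      z = n / β₁₃₄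

    -- Mirror image of `time-P₂-P₃`: here `z` equalises the two ways from b to d.
    time-P₁-P₃ : (α̂ / β₃₅) ⊔ (- α̂ / β₂) < Q → Q ≤ μ₂ →
             T⁺Eq[ Q ]≈ α₁₂ + Q * β₁₂ - (α̂ + Q * β₂) * β₂ / β₂₃₅
    time-P₁-P₃ max<Q Q≤μ₂ = T⁺Eq-from-flow (Q - z) 0# z
      (*-cancelˡ-0≤ β₂₃₅ (≤-respʳ
        (sym (modulo (- n) (⁻¹-inverseʳ β₂₃₅)
          (solve 6 (λ α̂ b₂ b₃ b₅ Q i →
            let n = α̂ :+ Q :* b₂ ; b₂₃₅ = b₂ :+ b₃ :+ b₅ in
            b₂₃₅ :* (Q :- n :* i) :=
            Q :* (b₃ :+ b₅) :- α̂ :+ :- n :* (b₂₃₅ :* i :- con (+ 1)))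
            refl α̂ β₂ β₃ β₅ Q i)))
        (x/z≤y⇒0≤yz-x (⊔-upperˡ max<Q))))
      ≤-refl
      (*-cancelˡ-0≤ β₂₃₅ (≤-respʳ
        (sym (modulo n (⁻¹-inverseʳ β₂₃₅)
          (solve 6 (λ α̂ b₂ b₃ b₅ Q i →
            let n = α̂ :+ Q :* b₂ ; b₂₃₅ = b₂ :+ b₃ :+ b₅ in
            b₂₃₅ :* (n :* i) :=
            Q :* b₂ :- :- α̂ :+ n :* (b₂₃₅ :* i :- con (+ 1)))
            refl α̂ β₂ β₃ β₅ Q i)))
        (x/z≤y⇒0≤yz-x (⊔-upperʳ max<Q))))
      (solve 2 (λ Q z → Q :- z :+ :0 :+ z := Q) refl Q z)
      (tight (solve 7 (λ a₁ a₂ b₁ b₂ Q n i →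
        time₁ a₁ a₂ b₁ b₂ (Q :- n :* i) (n :* i)
          :- (a₁ :+ a₂ :+ Q :* (b₁ :+ b₂) :- n :* b₂ :* i) := :0)
        refl α₁ α₂ β₁ β₂ Q n i))
      (slack refl (*-cancelˡ-0≤ β₂₃₅ (≤-respʳ
        (sym (modulo (β₂₅ * n) (⁻¹-inverseʳ β₂₃₅)
          (solve 12 (λ a₁ a₂ a₃ a₄ a₅ b₁ b₂ b₃ b₄ b₅ Q i →
            let n = a₂ :- (a₃ :+ a₅) :+ Q :* b₂ ; b₂₃₅ = b₂ :+ b₃ :+ b₅
                b₁₂ = b₁ :+ b₂ ; b₂₅ = b₂ :+ b₅
                α = a₄ :+ a₅ :- (a₁ :+ a₂) ; ᾱ = a₄ :- (a₁ :+ a₃) in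
            b₂₃₅ :* (time₂ a₄ a₅ b₄ b₅ :0 (n :* i)
                     :- (a₁ :+ a₂ :+ Q :* b₁₂ :- n :* b₂ :* i)) :=
            ᾱ :* b₂₅ :+ α :* b₃ :- Q :* (b₁ :* b₂₅ :+ b₃ :* b₁₂)
              :+ b₂₅ :* n :* (b₂₃₅ :* i :- con (+ 1)))
            refl α₁ α₂ α₃ α₄ α₅ β₁ β₂ β₃ β₄ β₅ Q i)))
        (y≤x/z⇒0≤x-yz Q≤μ₂))))
      (tight (modulo n (⁻¹-inverseʳ β₂₃₅)
        (solve 10 (λ a₁ a₂ a₃ a₅ b₁ b₂ b₃ b₅ Q i →
          let n = a₂ :- (a₃ :+ a₅) :+ Q :* b₂ ; b₂₃₅ = b₂ :+ b₃ :+ b₅ in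
          time₃ a₁ a₃ a₅ b₁ b₃ b₅ (Q :- n :* i) :0 (n :* i)
            :- (a₁ :+ a₂ :+ Q :* (b₁ :+ b₂) :- n :* b₂ :* i) :=
          :0 :+ n :* (b₂₃₅ :* i :- con (+ 1)))
          refl α₁ α₂ α₃ α₅ β₁ β₂ β₃ β₅ Q i)))
      where
      i n z : Carrier
      i = β₂₃₅ ⁻¹
      n = α̂ + Q * β₂
      z = n / β₂₃₅

    -- The flow `x` on `P₁` solves α₁₂ + β₁₂ x = α₄₅ + β₄₅ (Q - x). The maximum gives the signs of
    -- `x` and `Q - x`; the bound on `𝓑₁` says that `P₃` is not faster.
    time-P₁-P₂ : (α / β₁₂) ⊔ (- α / β₄₅) < Q → (α̂ * β₁₄ + ᾱ * β₂₅) / Q ≤ 𝓑₁ →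
             T⁺Eq[ Q ]≈ α₁₂ + (α + Q * β₄₅) * β₁₂ / β
    time-P₁-P₂ max<Q ≤𝓑₁ = T⁺Eq-from-flow x (Q - x) 0#
      (*-cancelˡ-0≤ β (≤-respʳ
        (sym (modulo n (⁻¹-inverseʳ β)
          (solve 7 (λ α b₁ b₂ b₄ b₅ Q i →
            let n = α :+ Q :* (b₄ :+ b₅) ; b = b₁ :+ b₂ :+ b₄ :+ b₅ in
            b :* (n :* i) := Q :* (b₄ :+ b₅) :- :- α :+ n :* (b :* i :- con (+ 1)))
            refl α β₁ β₂ β₄ β₅ Q i)))
        (x/z≤y⇒0≤yz-x (⊔-upperʳ max<Q))))
      (*-cancelˡ-0≤ β (≤-respʳ
        (sym (modulo (- n) (⁻¹-inverseʳ β)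
          (solve 7 (λ α b₁ b₂ b₄ b₅ Q i →
            let n = α :+ Q :* (b₄ :+ b₅) ; b = b₁ :+ b₂ :+ b₄ :+ b₅ in
            b :* (Q :- n :* i) := Q :* (b₁ :+ b₂) :- α :+ :- n :* (b :* i :- con (+ 1)))
            refl α β₁ β₂ β₄ β₅ Q i)))
        (x/z≤y⇒0≤yz-x (⊔-upperˡ max<Q))))
      ≤-refl
      (solve 2 (λ Q x → x :+ (Q :- x) :+ :0 := Q) refl Q x)
      (tight (solve 6 (λ a₁ a₂ b₁ b₂ n i →
        time₁ a₁ a₂ b₁ b₂ (n :* i) :0 :- (a₁ :+ a₂ :+ n :* (b₁ :+ b₂) :* i) := :0)
        refl α₁ α₂ β₁ β₂ n i))
      (tight (modulo (- n) (⁻¹-inverseʳ β)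
        (solve 10 (λ a₁ a₂ a₄ a₅ b₁ b₂ b₄ b₅ Q i →
          let n = a₄ :+ a₅ :- (a₁ :+ a₂) :+ Q :* (b₄ :+ b₅) ; b = b₁ :+ b₂ :+ b₄ :+ b₅ in
          time₂ a₄ a₅ b₄ b₅ (Q :- n :* i) :0 :- (a₁ :+ a₂ :+ n :* (b₁ :+ b₂) :* i) :=
          :0 :+ :- n :* (b :* i :- con (+ 1)))
          refl α₁ α₂ α₄ α₅ β₁ β₂ β₄ β₅ Q i)))
      (slack refl (*-cancelˡ-0≤ β (≤-respʳ
        (sym (modulo (- (β₂₅ * n)) (⁻¹-inverseʳ β)
          (solve 12 (λ a₁ a₂ a₃ a₄ a₅ b₁ b₂ b₃ b₄ b₅ Q i →
            let α = a₄ :+ a₅ :- (a₁ :+ a₂) ; ᾱ = a₄ :- (a₁ :+ a₃) ; α̂ = a₂ :- (a₃ :+ a₅)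
                n = α :+ Q :* (b₄ :+ b₅) ; b = b₁ :+ b₂ :+ b₄ :+ b₅
                b₁₄ = b₁ :+ b₄ ; b₂₅ = b₂ :+ b₅ in
            b :* (time₃ a₁ a₃ a₅ b₁ b₃ b₅ (n :* i) (Q :- n :* i) :0
                  :- (a₁ :+ a₂ :+ n :* (b₁ :+ b₂) :* i)) :=
            (b₁ :* b₅ :- b₂ :* b₄) :* Q :- (α̂ :* b₁₄ :+ ᾱ :* b₂₅)
              :+ :- (b₂₅ :* n) :* (b :* i :- con (+ 1)))
            refl α₁ α₂ α₃ α₄ α₅ β₁ β₂ β₃ β₄ β₅ Q i)))
        (x/z≤y⇒0≤yz-x ≤𝓑₁))))
      where
      i n x : Carrier
      i = β ⁻¹
      n = α + Q * β₄₅
      x = n / β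

    private
      -- `μ₁` is `F₁ / E₁`, `μ₂` is `F₂ / E₂`, and `M / D` is the flow on `P₃` when all paths are
      -- used.
      D M E₁ E₂ F₁ F₂ : Carrier
      D = β₃ * β + β₁₄ * β₂₅
      M = ᾱ * β - α * β₁₄ - Q * 𝓑₁
      E₁ = β₃ * β₄₅ + β₅ * β₁₄
      E₂ = β₁ * β₂₅ + β₃ * β₁₂
      F₁ = α̂ * β₁₄ - α * β₃
      F₂ = ᾱ * β₂₅ + α * β₃

    -- Equal times on `P₁` and `P₂` determine `x` from the flow `g` on `P₃`; equality with `P₃` then
    -- becomes `D * g ≈ M`. Multiplied by `D`, the three flows turn into the three inequalities of
    -- the hypotheses.
    time-all-paths : μ₁ ⊔ μ₂ < Q → 𝓑₁ < (α̂ * β₁₄ + ᾱ * β₂₅) / Q →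
             T⁺Eq[ Q ]≈ α₁₂ + (α + Q * β₄₅) * β₁₂ / β + M / D * 𝓑₁ / β
    time-all-paths max<Q 𝓑₁< = T⁺Eq-from-flow x (Q - x - g) g
      (*-cancelˡ-0≤ D (≤-respʳ (sym D*x≈) (x/z≤y⇒0≤yz-x (⊔-upperˡ max<Q))))
      (*-cancelˡ-0≤ D (≤-respʳ (sym D*y≈) (x/z≤y⇒0≤yz-x (⊔-upperʳ max<Q))))
      (*-cancelˡ-0≤ D (≤-respʳ (sym D*g≈) (y≤x/z⇒0≤x-yz (<⇒≤ 𝓑₁<))))
      (solve 3 (λ Q x g → x :+ (Q :- x :- g) :+ g := Q) refl Q x g)
      -- For `P₁` and `P₂` the solver treats `g` as a free variable: their times agree for every
      -- flow on `P₃`.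
      (tight (modulo (- (g * β₁)) (⁻¹-inverseʳ β)
        (solve 9 (λ a₁ a₂ b₁ b₂ b₄ b₅ n g j →
          let b = b₁ :+ b₂ :+ b₄ :+ b₅ in
          time₁ a₁ a₂ b₁ b₂ ((n :- g :* (b₁ :+ b₄)) :* j) g
            :- (a₁ :+ a₂ :+ n :* (b₁ :+ b₂) :* j :+ g :* (b₁ :* b₅ :- b₂ :* b₄) :* j) :=
          :0 :+ :- (g :* b₁) :* (b :* j :- con (+ 1)))
          refl α₁ α₂ β₁ β₂ β₄ β₅ n g j)))
      (tight (modulo (- (n - g * β₁₄) - g * β₁) (⁻¹-inverseʳ β)
        (solve 11 (λ a₁ a₂ a₄ a₅ b₁ b₂ b₄ b₅ Q g j →
          let b = b₁ :+ b₂ :+ b₄ :+ b₅ ; b₁₄ = b₁ :+ b₄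
              n = a₄ :+ a₅ :- (a₁ :+ a₂) :+ Q :* (b₄ :+ b₅) in
          time₂ a₄ a₅ b₄ b₅ (Q :- (n :- g :* b₁₄) :* j :- g) g
            :- (a₁ :+ a₂ :+ n :* (b₁ :+ b₂) :* j :+ g :* (b₁ :* b₅ :- b₂ :* b₄) :* j) :=
          :0 :+ (:- (n :- g :* b₁₄) :- g :* b₁) :* (b :* j :- con (+ 1)))
          refl α₁ α₂ α₄ α₅ β₁ β₂ β₄ β₅ Q g j)))
      -- Only here does the value of `g` enter: `β` times the excess of `P₃` is `D * g - M`.
      (tight (*-cancelˡ-≈0 β (modulo 1# D*g≈M (modulo (- (β₂₅ * (n - g * β₁₄)) - β * (g * β₁)) (⁻¹-inverseʳ β)
        (solve 13 (λ a₁ a₂ a₃ a₄ a₅ b₁ b₂ b₃ b₄ b₅ Q g j →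
          let b = b₁ :+ b₂ :+ b₄ :+ b₅ ; b₁₄ = b₁ :+ b₄ ; b₂₅ = b₂ :+ b₅
              𝓑₁ = b₁ :* b₅ :- b₂ :* b₄
              α = a₄ :+ a₅ :- (a₁ :+ a₂) ; ᾱ = a₄ :- (a₁ :+ a₃)
              n = α :+ Q :* (b₄ :+ b₅) in
          b :* (time₃ a₁ a₃ a₅ b₁ b₃ b₅ ((n :- g :* b₁₄) :* j) (Q :- (n :- g :* b₁₄) :* j :- g) g
            :- (a₁ :+ a₂ :+ n :* (b₁ :+ b₂) :* j :+ g :* 𝓑₁ :* j)) :=
          :0 :+ con (+ 1) :* ((b₃ :* b :+ b₁₄ :* b₂₅) :* g :- (ᾱ :* b :- α :* b₁₄ :- Q :* 𝓑₁))
            :+ (:- (b₂₅ :* (n :- g :* b₁₄)) :- b :* (g :* b₁)) :* (b :* j :- con (+ 1)))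
          refl α₁ α₂ α₃ α₄ α₅ β₁ β₂ β₃ β₄ β₅ Q g j)))))
      where
      j n g x : Carrier
      j = β ⁻¹
      n = α + Q * β₄₅
      g = M / D
      x = (n - g * β₁₄) / β

      -- The identities below keep `α`, `ᾱ`, `α̂` as atoms, so their linear dependence has to be
      -- supplied to `modulo`.
      α̂≈ᾱ-α : α̂ ≈ ᾱ - α
      α̂≈ᾱ-α = solve 5 (λ a₁ a₂ a₃ a₄ a₅ →
        a₂ :- (a₃ :+ a₅) := a₄ :- (a₁ :+ a₃) :- (a₄ :+ a₅ :- (a₁ :+ a₂)))
        refl α₁ α₂ α₃ α₄ α₅

      D*g≈M : D * g ≈ M
      D*g≈M = trans (*-comm D g) (x/y*y≈x M D)

      D*g≈ : D * g ≈ α̂ * β₁₄ + ᾱ * β₂₅ - 𝓑₁ * Q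
      D*g≈ = trans D*g≈M (modulo (- β₁₄) α̂≈ᾱ-α
        (solve 9 (λ α ᾱ α̂ b₁ b₂ b₄ b₅ Q B →
          let b = b₁ :+ b₂ :+ b₄ :+ b₅ ; b₁₄ = b₁ :+ b₄ ; b₂₅ = b₂ :+ b₅ in
          ᾱ :* b :- α :* b₁₄ :- Q :* B :=
          α̂ :* b₁₄ :+ ᾱ :* b₂₅ :- B :* Q :+ :- b₁₄ :* (α̂ :- (ᾱ :- α)))
          refl α ᾱ α̂ β₁ β₂ β₄ β₅ Q 𝓑₁))

      D*x≈ : D * x ≈ Q * E₁ - F₁
      D*x≈ = modulo β₁₄ α̂≈ᾱ-α
        (modulo (Q * E₁ - ((ᾱ - α) * β₁₄ - α * β₃)) (⁻¹-inverseʳ β)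
        (modulo (- (β₁₄ * j)) D*g≈M
        (solve 11 (λ α ᾱ α̂ b₁ b₂ b₃ b₄ b₅ Q g j →
          let b = b₁ :+ b₂ :+ b₄ :+ b₅ ; b₁₄ = b₁ :+ b₄ ; b₂₅ = b₂ :+ b₅ ; b₄₅ = b₄ :+ b₅
              D = b₃ :* b :+ b₁₄ :* b₂₅
              M = ᾱ :* b :- α :* b₁₄ :- Q :* (b₁ :* b₅ :- b₂ :* b₄)
              E₁ = b₃ :* b₄₅ :+ b₅ :* b₁₄
              n = α :+ Q :* b₄₅ in
          D :* ((n :- g :* b₁₄) :* j) :=
          Q :* E₁ :- (α̂ :* b₁₄ :- α :* b₃)
            :+ b₁₄ :* (α̂ :- (ᾱ :- α))
            :+ (Q :* E₁ :- ((ᾱ :- α) :* b₁₄ :- α :* b₃)) :* (b :* j :- con (+ 1))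
            :+ :- (b₁₄ :* j) :* (D :* g :- M))
          refl α ᾱ α̂ β₁ β₂ β₃ β₄ β₅ Q g j)))

      -- Follows from the products for `x` and `g`, because `E₁ + E₂` equals `D + 𝓑₁` and `F₁ + F₂`
      -- equals `α̂ * β₁₄ + ᾱ * β₂₅`.
      D*y≈ : D * (Q - x - g) ≈ Q * E₂ - F₂
      D*y≈ = modulo (- 1#) D*x≈ (modulo (- 1#) D*g≈M (modulo β₁₄ α̂≈ᾱ-α
        (solve 11 (λ α ᾱ α̂ b₁ b₂ b₃ b₄ b₅ Q g x →
          let b = b₁ :+ b₂ :+ b₄ :+ b₅ ; b₁₄ = b₁ :+ b₄ ; b₂₅ = b₂ :+ b₅
              D = b₃ :* b :+ b₁₄ :* b₂₅
              M = ᾱ :* b :- α :* b₁₄ :- Q :* (b₁ :* b₅ :- b₂ :* b₄)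
              E₁ = b₃ :* (b₄ :+ b₅) :+ b₅ :* b₁₄
              F₁ = α̂ :* b₁₄ :- α :* b₃ in
          D :* (Q :- x :- g) :=
          Q :* (b₁ :* b₂₅ :+ b₃ :* (b₁ :+ b₂)) :- (ᾱ :* b₂₅ :+ α :* b₃)
            :+ :- con (+ 1) :* (D :* x :- (Q :* E₁ :- F₁))
            :+ :- con (+ 1) :* (D :* g :- M)
            :+ b₁₄ :* (α̂ :- (ᾱ :- α)))
          refl α ᾱ α̂ β₁ β₂ β₃ β₄ β₅ Q g x)))

lemma2 : ∀ {c ℓ₁ ℓ₂ : Level} (ℝ : Reals c ℓ₁ ℓ₂) (N : Network ℝ) →
    let open Reals ℝ
        open Network N in
    ∀ (Q : Carrier) ⦃ Q-pos : Positive Q ⦄ →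
    -- (a)
    (0# < Q × Q ≤ (α̂ / β₃₅) ⊓ (ᾱ / β₁₃) →
      T⁺Eq[ Q ]≈ α₁₃₅ + Q * β₁₃₅) ×
    -- (b)
    (0# < Q × Q ≤ (- α / β₄₅) ⊓ (- ᾱ / β₄) →
      T⁺Eq[ Q ]≈ α₄₅ + Q * β₄₅) ×
    -- (c)
    (0# < Q × Q ≤ (α / β₁₂) ⊓ (- α̂ / β₂) →
      T⁺Eq[ Q ]≈ α₁₂ + Q * β₁₂) ×
    -- (d)
    ((ᾱ / β₁₃) ⊔ (- ᾱ / β₄) < Q × Q ≤ μ₁ →
      T⁺Eq[ Q ]≈ α₄₅ + Q * β₄₅ - (ᾱ + Q * β₄) * β₄ / β₁₃₄) ×
    -- (e)
    ((α̂ / β₃₅) ⊔ (- α̂ / β₂) < Q × Q ≤ μ₂ →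
      T⁺Eq[ Q ]≈ α₁₂ + Q * β₁₂ - (α̂ + Q * β₂) * β₂ / β₂₃₅) ×
    -- (f)
    ((α / β₁₂) ⊔ (- α / β₄₅) < Q × (α̂ * β₁₄ + ᾱ * β₂₅) / Q ≤ 𝓑₁ →
      T⁺Eq[ Q ]≈ α₁₂ + (α + Q * β₄₅) * β₁₂ / β) ×
    -- (g)
    (let g = (ᾱ * β - α * β₁₄ - Q * 𝓑₁) / (β₃ * β + β₁₄ * β₂₅) in
     μ₁ ⊔ μ₂ < Q × 𝓑₁ < (α̂ * β₁₄ + ᾱ * β₂₅) / Q →
      T⁺Eq[ Q ]≈ α₁₂ + (α + Q * β₄₅) * β₁₂ / β + g * 𝓑₁ / β)
lemma2 ℝ N Q =
    (λ (_ , Q≤) → time-only-P₃ Q Q≤)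
  , (λ (_ , Q≤) → time-only-P₂ Q Q≤)
  , (λ (_ , Q≤) → time-only-P₁ Q Q≤)
  , (λ (max<Q , Q≤μ₁) → time-P₂-P₃ Q max<Q Q≤μ₁)
  , (λ (max<Q , Q≤μ₂) → time-P₁-P₃ Q max<Q Q≤μ₂)
  , (λ (max<Q , ≤𝓑₁) → time-P₁-P₂ Q max<Q ≤𝓑₁)
  , (λ (max<Q , 𝓑₁<) → time-all-paths Q max<Q 𝓑₁<)
  where open NetworkProperties ℝ N
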